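{- Let $\Gamma=(V_\Gamma,E_\Gamma,s,t)$ be a finite strongly connected $k$-out graph without parallel edges and without loops, and let $H$ be a nontrivial finite group. Assume that $|V_\Gamma|\ge d(H)$. Let $\Gamma^\sharp$ be the graph obtained from $\Gamma$ by adding exactly one loop at every vertex. Then there exist a finite strongly connected $(k+1)$-out graph $G$ and a graph congruence $\rho$ on $G$ such that \[ G/\rho\cong \Gamma^\sharp,\qquad \operatorname{Aut}(G)\cong H, \] and $G$ is not totally synchronizing.
   Context: A graph is a finite directed multigraph $G=(V,E,s,t)$ with source and target maps $s,t:E\to V$ (in general loops and parallel edges, i.e. distinct edges with the same source and the same target, are allowed). It is $k$-out if every vertex has exactly $k$ outgoing edges. An isomorphism of graphs is a pair of bijections on vertices and on edges commuting with $s$ and $t$; $\operatorname{Aut}(G)$ is the group of automorphisms. $d(H)$ denotes the minimal size of a generating set of the group $H$. Given an equivalence relation $\rho$ on $V(G)$, the quotient $G/\rho$ has vertex set $V(G)/\rho$ and, for each pair of classes $C,D$, exactly $\max_{p\in C}|\{e\in E: s(e)=p,\ t(e)\in D\}|$ parallel edges from $C$ to $D$. For a $k$-out graph $G$, $\rho$ is a (graph) congruence if $G/\rho$ is again $k$-out; equivalently, for all classes $C,D$ all vertices of $C$ have the same number of outgoing edges ending in $D$. A coloring of a $k$-out graph $G$ is a map $\chi:E\to[k]=\{1,\dots,k\}$ whose restriction to the set of outgoing edges of each vertex is a bijection onto $[k]$. It defines the deterministic complete automaton $\chi(G)=(V,[k],\delta_\chi)$, where $\delta_\chi(v,a)=t(e)$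 for the unique edge $e$ with $s(e)=v$, $\chi(e)=a$. The automaton is synchronizing if there is a word $w\in[k]^*$ with $|V\cdot w|=1$. $G$ is totally synchronizing if $\chi(G)$ is synchronizing for every coloring $\chi$ of $G$. -}

module Defs where

open import Algebra.Bundles using (Group)
open import Algebra.Morphism.Structures using (module GroupMorphisms)
open import Data.Fin.Base using (Fin; toℕ; cast)
import Data.Fin.Properties as Fin
open import Data.List.Base using (List; length; map; filter; foldl; concatMap; allFin; _++_; deduplicate)
open import Data.List.Extrema.Nat using (max)
open import Data.List.Membership.Propositional.Properties using (∈-allFin)
import Data.List.Properties as List
import Data.List.Relation.Unary.Any as Any
import Data.List.Relation.Unary.Any.Properties as Any
open import Data.List.Relation.Unary.Enumerates.Setoid using (IsEnumeration)
import Data.List.Relation.Unary.Enumerates.Setoid.Properties as Enumerates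
import Data.List.Relation.Unary.Unique.DecSetoid.Properties as UniqueDec
import Data.List.Relation.Unary.Unique.Setoid as Unique
open import Data.Nat.Base using (ℕ; suc; _≤_)
import Data.Nat.Properties as ℕ
open import Data.Product.Base using (Σ; ∃; _×_; _,_; proj₁; proj₂)
open import Data.Sum.Base using ([_,_]; inj₁; inj₂)
open import Data.Sum.Relation.Binary.Pointwise using (_⊎ₛ_; ⊎-decidable)
import Data.Sum.Relation.Binary.Pointwise as ⊎
open import Function.Base using (_∘_; id)
open import Function.Bundles using (Func; Inverse)
import Function.Construct.Composition as Composition
import Function.Construct.Identity as Identity
import Function.Construct.Symmetry as Symmetry
open import Function.Definitions using (Injective; Bijective)
open import Level using (Level; 0ℓ; _⊔_)
open import Relation.Binary.Bundles using (Setoid; DecSetoid)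
open import Relation.Binary.Core using (Rel)
import Relation.Binary.Construct.On as On
open import Relation.Binary.Definitions using (Decidable)
open import Relation.Binary.PropositionalEquality as ≡ using (_≡_)
open import Relation.Binary.Structures using (IsEquivalence)
open import Relation.Nullary using (¬_)
open import Relation.Nullary.Decidable using (_×-dec_)
import Relation.Unary as U

private
  variable
    a b c ℓ ℓ₁ ℓ₂ : Level

-- Sets are setoids throughout, so that the vertex set V/ρ of a quotient
-- graph is V itself, compared by ρ.  A finite set has decidable equality
-- and a duplicate-free listing of its elements.
record Finite (S : Setoid a ℓ) : Set (a ⊔ ℓ) where
  open Setoid S
  field
    _≟_      : Decidable _≈_
    elements : List Carrier
    complete : IsEnumeration S elements
    unique   : Unique.Unique S elements

  decSetoid : DecSetoid a ℓ
  decSetoid = record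
    { isDecEquivalence = record { isEquivalence = isEquivalence ; _≟_ = _≟_ } }

  card : ℕ
  card = length elements

  -- Number of elements satisfying P; meaningful when P respects _≈_.
  count : ∀ {p} {P : U.Pred Carrier p} → U.Decidable P → ℕ
  count P? = length (filter P? elements)

enumerated : (S : Setoid a ℓ) → Decidable (Setoid._≈_ S) →
             ∀ xs → IsEnumeration S xs → Finite S
enumerated S _≟_ xs xs-complete = record
  { _≟_      = _≟_
  ; elements = deduplicate _≟_ xs
  ; complete = Enumerates.deduplicate⁺ DS xs-complete
  ; unique   = UniqueDec.deduplicate-! DS xs
  }
  where
  DS : DecSetoid _ _
  DS = record { isDecEquivalence = record
         { isEquivalence = Setoid.isEquivalence S ; _≟_ = _≟_ } }

record Graph : Set₁ where
  field
    V E    : Setoid 0ℓ 0ℓ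
    source : Func E V
    target : Func E V
    finV   : Finite V
    finE   : Finite E

  open Setoid V public using () renaming (Carrier to Vertex; _≈_ to _≈ᵥ_)
  open Setoid E public using () renaming (Carrier to Edge; _≈_ to _≈ₑ_)
  open Finite finV public using () renaming
    (_≟_ to _≟ᵥ_; elements to vertices; card to #V)
  open Finite finE public using () renaming
    (_≟_ to _≟ₑ_; elements to edges; count to #E)

  s t : Edge → Vertex
  s = Func.to source
  t = Func.to target

  -- The empty walk must allow for _≈ᵥ_, not just _≡_, so Star does not apply.
  data Path : Rel Vertex 0ℓ where
    nil  : ∀ {u v} → u ≈ᵥ v → Path u v
    cons : ∀ {u v} (e : Edge) → s e ≈ᵥ u → Path (t e) v → Path u v

  StronglyConnected : Set
  StronglyConnected = ∀ u v → Path u v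

  NoLoops : Set
  NoLoops = ∀ e → ¬ (s e ≈ᵥ t e)

  NoParallelEdges : Set
  NoParallelEdges = ∀ e e′ → s e ≈ᵥ s e′ → t e ≈ᵥ t e′ → e ≈ₑ e′

  IsOut : ℕ → Set
  IsOut k = ∀ v → #E (λ e → s e ≟ᵥ v) ≡ k

  Out : Vertex → Setoid 0ℓ 0ℓ
  Out v = record
    { Carrier       = Σ Edge λ e → s e ≈ᵥ v
    ; isEquivalence = On.isEquivalence proj₁ (Setoid.isEquivalence E)
    }

open Graph using (StronglyConnected; NoLoops; NoParallelEdges; IsOut; #V) public

record _≅_ (G K : Graph) : Set where
  private
    module G = Graph G
    module K = Graph K
  field
    onV : Inverse G.V K.V
    onE : Inverse G.E K.E

  v⟨_⟩ : G.Vertex → K.Vertex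
  v⟨_⟩ = Inverse.to onV

  e⟨_⟩ : G.Edge → K.Edge
  e⟨_⟩ = Inverse.to onE

  field
    source-comm : ∀ e → K.s e⟨ e ⟩ K.≈ᵥ v⟨ G.s e ⟩
    target-comm : ∀ e → K.t e⟨ e ⟩ K.≈ᵥ v⟨ G.t e ⟩

open _≅_

≅-refl : ∀ {G} → G ≅ G
≅-refl {G} = record
  { onV = Identity.inverse (Graph.V G)
  ; onE = Identity.inverse (Graph.E G)
  ; source-comm = λ _ → Setoid.refl (Graph.V G)
  ; target-comm = λ _ → Setoid.refl (Graph.V G)
  }

≅-sym : ∀ {G K} → G ≅ K → K ≅ G
≅-sym {G} {K} f = record
  { onV = Symmetry.inverse (onV f)
  ; onE = Symmetry.inverse (onE f)
  ; source-comm = λ e → G.sym (Inverse.inverseʳ (onV f)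
      (K.trans (K.sym (Func.cong (Graph.source K) (Inverse.strictlyInverseˡ (onE f) e)))
               (source-comm f (Inverse.from (onE f) e))))
  ; target-comm = λ e → G.sym (Inverse.inverseʳ (onV f)
      (K.trans (K.sym (Func.cong (Graph.target K) (Inverse.strictlyInverseˡ (onE f) e)))
               (target-comm f (Inverse.from (onE f) e))))
  }
  where
  module G = Setoid (Graph.V G)
  module K = Setoid (Graph.V K)

≅-trans : ∀ {G K L} → G ≅ K → K ≅ L → G ≅ L
≅-trans {L = L} f g = record
  { onV = Composition.inverse (onV f) (onV g)
  ; onE = Composition.inverse (onE f) (onE g)
  ; source-comm = λ e → trans (source-comm g _) (Inverse.to-cong (onV g) (source-comm f e))
  ; target-comm = λ e → trans (target-comm g _) (Inverse.to-cong (onV g) (target-comm f e))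
  }
  where open Setoid (Graph.V L)

Aut : Graph → Group 0ℓ 0ℓ
Aut G = record
  { Carrier = G ≅ G
  ; _≈_ = λ f g → (∀ v → v⟨ f ⟩ v ≈ᵥ v⟨ g ⟩ v) × (∀ e → e⟨ f ⟩ e ≈ₑ e⟨ g ⟩ e)
  ; _∙_ = λ f g → ≅-trans g f
  ; ε   = ≅-refl
  ; _⁻¹ = ≅-sym
  ; isGroup = record
    { isMonoid = record
      { isSemigroup = record
        { isMagma = record
          { isEquivalence = record
            { refl  = (λ _ → V.refl) , (λ _ → E.refl)
            ; sym   = λ (p , q) → (λ v → V.sym (p v)) , (λ e → E.sym (q e))
            ; trans = λ (p , q) (p′ , q′) →
                (λ v → V.trans (p v) (p′ v)) , (λ e → E.trans (q e) (q′ e))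
            }
          ; ∙-cong = λ {f} {f′} (p , q) (p′ , q′) →
              (λ v → V.trans (Inverse.to-cong (onV f) (p′ v)) (p _)) ,
              (λ e → E.trans (Inverse.to-cong (onE f) (q′ e)) (q _))
          }
        ; assoc = λ _ _ _ → (λ _ → V.refl) , (λ _ → E.refl)
        }
      ; identity = (λ _ → (λ _ → V.refl) , (λ _ → E.refl))
                 , (λ _ → (λ _ → V.refl) , (λ _ → E.refl))
      }
    ; inverse = (λ f → Inverse.strictlyInverseʳ (onV f) , Inverse.strictlyInverseʳ (onE f))
              , (λ f → Inverse.strictlyInverseˡ (onV f) , Inverse.strictlyInverseˡ (onE f))
    ; ⁻¹-cong = λ {f} {g} (p , q) →
        (λ v → Inverse.inverseʳ (onV f)
                 (V.trans (V.sym (Inverse.strictlyInverseˡ (onV g) v)) (V.sym (p _)))) ,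
        (λ e → Inverse.inverseʳ (onE f)
                 (E.trans (E.sym (Inverse.strictlyInverseˡ (onE g) e)) (E.sym (q _))))
    }
  }
  where
  open Graph G
  module V = Setoid V
  module E = Setoid E

-- Classically, decidability is no restriction.
record VertexEquivalence (G : Graph) : Set₁ where
  open Graph G
  field
    _~_           : Rel Vertex 0ℓ
    isEquivalence : IsEquivalence _~_
    ≈⇒~           : ∀ {u v} → u ≈ᵥ v → u ~ v
    _~?_          : Decidable _~_

  classes : Setoid 0ℓ 0ℓ
  classes = record { isEquivalence = isEquivalence }

  open IsEquivalence isEquivalence public

  -- Number of edges of the quotient from the class of p to the class of q.
  multiplicity : Vertex → Vertex → ℕ
  multiplicity p q =
    max 0 (map (λ p′ → #E (λ e → (s e ≟ᵥ p′) ×-dec (t e ~? q)))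
               (filter (p ~?_) vertices))

  multiplicity-cong : ∀ {p p′ q q′} → p ~ p′ → q ~ q′ →
                      multiplicity p q ≡ multiplicity p′ q′
  multiplicity-cong {p} {p′} {q} {q′} p~p′ q~q′ = ≡.cong (max 0) (≡.trans
    (List.map-cong (λ r → ≡.cong length (List.filter-≐
        (λ e → (s e ≟ᵥ r) ×-dec (t e ~? q)) (λ e → (s e ≟ᵥ r) ×-dec (t e ~? q′))
        ( (λ (x , y) → x , trans y q~q′) , (λ (x , y) → x , trans y (sym q~q′)) )
        edges))
      (filter (p ~?_) vertices))
    (≡.cong (map _) (List.filter-≐ (p ~?_) (p′ ~?_)
        (trans (sym p~p′) , trans p~p′) vertices)))

-- The edges of G / ρ are the triples (C , D , i) with i below the
-- multiplicity; C and D are given by representatives, hence the use of toℕ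
-- when comparing the indices i.
_/_ : (G : Graph) → VertexEquivalence G → Graph
G / ρ = record
  { V      = classes
  ; E      = quotE
  ; source = record { to = proj₁ ; cong = proj₁ }
  ; target = record { to = proj₁ ∘ proj₂ ; cong = proj₁ ∘ proj₂ }
  ; finV   = enumerated classes _~?_ vertices
               (λ v → Any.map ≈⇒~ (Finite.complete finV v))
  ; finE   = enumerated quotE
               (λ (p , q , i) (p′ , q′ , i′) →
                  (p ~? p′) ×-dec ((q ~? q′) ×-dec (toℕ i ℕ.≟ toℕ i′)))
               listing listing-complete
  }
  where
  open Graph G
  open VertexEquivalence ρ

  QuotEdge : Set
  QuotEdge = Σ Vertex λ p → Σ Vertex λ q → Fin (multiplicity p q)

  quotE : Setoid 0ℓ 0ℓ
  quotE = record
    { Carrier = QuotEdge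
    ; _≈_ = λ (p , q , i) (p′ , q′ , i′) → p ~ p′ × q ~ q′ × toℕ i ≡ toℕ i′
    ; isEquivalence = record
      { refl  = refl , refl , ≡.refl
      ; sym   = λ (x , y , z) → sym x , sym y , ≡.sym z
      ; trans = λ (x , y , z) (x′ , y′ , z′) → trans x x′ , trans y y′ , ≡.trans z z′
      }
    }

  listing : List QuotEdge
  listing = concatMap (λ p → concatMap (λ q →
              map (λ i → p , q , i) (allFin (multiplicity p q))) vertices) vertices

  listing-complete : IsEnumeration quotE listing
  listing-complete (p , q , i) =
    Any.concatMap⁺ _ (Any.map (λ p≈p′ →
      Any.concatMap⁺ _ (Any.map (λ q≈q′ →
        Any.map⁺ (Any.map
          (λ {j} eq → ≈⇒~ p≈p′ , ≈⇒~ q≈q′ ,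
             ≡.trans (≡.sym (Fin.toℕ-cast _ i)) (≡.cong toℕ eq))
          (∈-allFin (cast (multiplicity-cong (≈⇒~ p≈p′) (≈⇒~ q≈q′)) i))))
        (Finite.complete finV q)))
      (Finite.complete finV p))

-- For a k-out graph G.
IsCongruence : ℕ → (G : Graph) → VertexEquivalence G → Set
IsCongruence k G ρ = IsOut (G / ρ) k

_♯ : Graph → Graph
G ♯ = record
  { V      = V
  ; E      = E ⊎ₛ V
  ; source = record { to = [ s , id ] ; cong = λ where
      (⊎.inj₁ p) → Func.cong source p
      (⊎.inj₂ p) → p }
  ; target = record { to = [ t , id ] ; cong = λ where
      (⊎.inj₁ p) → Func.cong target p
      (⊎.inj₂ p) → p }
  ; finV   = finV
  ; finE   = enumerated (E ⊎ₛ V) (⊎-decidable _≟ₑ_ _≟ᵥ_)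
               (map inj₁ edges ++ map inj₂ vertices)
               (Enumerates.++⁺ E V (Finite.complete finE) (Finite.complete finV))
  }
  where open Graph G

record Coloring (k : ℕ) (G : Graph) : Set where
  open Graph G
  field
    χ         : Func E (≡.setoid (Fin k))
    bijective : ∀ v → Bijective (Setoid._≈_ (Out v)) _≡_ (Func.to χ ∘ proj₁)

  δ : Vertex → Fin k → Vertex
  δ v c = t (proj₁ (proj₁ (proj₂ (bijective v) c)))

  _·_ : Vertex → List (Fin k) → Vertex
  _·_ = foldl δ

  ∣V·_∣ : List (Fin k) → ℕ
  ∣V· w ∣ = length (deduplicate _≟ᵥ_ (map (_· w) vertices))

  Synchronizing : Set
  Synchronizing = ∃ λ w → ∣V· w ∣ ≡ 1

TotallySynchronizing : ℕ → Graph → Set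
TotallySynchronizing k G = ∀ (χ : Coloring k G) → Coloring.Synchronizing χ

module _ (H : Group c ℓ) where
  open Group H

  Nontrivial : Set (c ⊔ ℓ)
  Nontrivial = ∃ λ x → ¬ (x ≈ ε)

  data ⟨_⟩ {m : ℕ} (g : Fin m → Carrier) : Carrier → Set (c ⊔ ℓ) where
    gen  : ∀ i → ⟨ g ⟩ (g i)
    unit : ⟨ g ⟩ ε
    mul  : ∀ {x y} → ⟨ g ⟩ x → ⟨ g ⟩ y → ⟨ g ⟩ (x ∙ y)
    inv  : ∀ {x} → ⟨ g ⟩ x → ⟨ g ⟩ (x ⁻¹)
    resp : ∀ {x y} → x ≈ y → ⟨ g ⟩ x → ⟨ g ⟩ y

  -- Injectivity makes g an m-element subset rather than a family.
  HasGeneratingSet : ℕ → Set (c ⊔ ℓ)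
  HasGeneratingSet m = Σ (Fin m → Carrier) λ g →
    Injective _≡_ _≈_ g × (∀ x → ⟨ g ⟩ x)

  -- Says that d = d(H).
  IsRank : ℕ → Set (c ⊔ ℓ)
  IsRank d = HasGeneratingSet d × (∀ m → HasGeneratingSet m → d ≤ m)

FiniteGroup : Group c ℓ → Set (c ⊔ ℓ)
FiniteGroup H = Finite (Group.setoid H)

_≅ᴳ_ : Group a ℓ₁ → Group b ℓ₂ → Set (a ⊔ b ⊔ ℓ₁ ⊔ ℓ₂)
H ≅ᴳ K = ∃ λ f → GroupMorphisms.IsGroupIsomorphism (Group.rawGroup H) (Group.rawGroup K) f

{-# OPTIONS --safe #-}
module Submission where

-- Number the vertices of Γ as 0, …, m and attach a generator of H to each.
-- Over the vertex a put the triples (a , h , j) with h ∈ H and j ≤ a, where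
-- the edge replacing the loop goes down the chain j = a, …, 0 and from j = 0
-- jumps to the entrance j = a after multiplying h by the generator of a, and
-- where each edge a → b of Γ leads from every (a , h , j) to the entrance
-- over b with the same h.  Left multiplication by H acts freely and preserves
-- the labels of all edges, so the labelled automaton has no reset word.
--
-- Conversely, entrances have several in-neighbours while all other vertices
-- have just one.  Hence an automorphism preserves entrances, then heights j,
-- then classes, as the entrance over a is at height a.  Since an edge is
-- determined by its source and the class of its target, the automorphism
-- preserves labels, and by strong connectivity it is the left multiplication
-- that agrees with it at one vertex.

open import Defs
open import Algebra.Bundles using (Group)
open import Data.Fin.Base using (Fin; zero; suc; toℕ; fromℕ; inject₁; inject≤; fromℕ<)
open import Data.Fin.Induction using (<-weakInduction; >-weakInduction)
import Data.Fin.Permutation as Perm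
import Data.Fin.Properties as Fin
open import Data.List.Base
  using (List; []; _∷_; length; lookup; filter; map; allFin; cartesianProduct; foldl; concatMap; deduplicate)
import Data.List.Extrema.Nat as Extrema
open import Data.List.Membership.Propositional.Properties
  using (∈-allFin; ∈-lookup; ∈-map⁺; ∈-deduplicate⁺; ∈-cartesianProduct⁺)
open import Data.List.Membership.Propositional using (_∈_)
import Data.List.Membership.Setoid.Properties as Membershipₚ
import Data.List.Relation.Unary.All as All
import Data.List.Relation.Unary.All.Properties as All
import Data.List.Relation.Unary.AllPairs as AllPairs
import Data.List.Relation.Unary.Any as Any
import Data.List.Relation.Unary.Any.Properties as Any
import Data.List.Relation.Unary.Unique.Setoid as Unique
import Data.List.Relation.Unary.Unique.Setoid.Properties as Uniqueₚ
open import Data.Nat.Base using (ℕ; zero; suc; _≤_; _<_; z≤n; s≤s) renaming (_+_ to _ℕ+_)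
import Data.Nat.Properties as ℕ
open import Data.Product.Base using (Σ; ∃; _×_; _,_; proj₁; proj₂; uncurry)
import Data.Product.Properties as Product
open import Data.Sum.Base using (inj₁; inj₂)
import Data.Sum.Relation.Binary.Pointwise as ⊎
open import Function.Base using (_∘_)
open import Function.Bundles using (Func; Inverse; Bijection)
import Function.Construct.Composition as Composition
import Function.Construct.Symmetry as Symmetry
open import Function.Properties.Bijection using (Bijection⇒Inverse)
open import Function.Properties.Inverse using (Inverse⇒Bijection)
open import Level using (Level; 0ℓ; _⊔_)
open import Relation.Binary.Bundles using (Setoid)
import Relation.Binary.Construct.On as On
open import Relation.Binary.PropositionalEquality as ≡ using (_≡_; _≢_)
open import Relation.Nullary using (¬_; Dec; yes; no; contradiction)
open import Relation.Nullary.Decidable using (_×-dec_)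
import Relation.Unary as U

private
  variable
    a ℓ p : Level
    X Y : Set
    k m n : ℕ

-- Finite setoids and counting.

mk↔ₛ : {A : Set a} (S : Setoid p ℓ) → let open Setoid S in (f : A → Carrier) →
       (∀ {x y} → f x ≈ f y → x ≡ y) → (∀ y → ∃ λ x → f x ≈ y) →
       Inverse (≡.setoid A) S
mk↔ₛ S f inj surj = Bijection⇒Inverse record
  { to        = f
  ; cong      = λ { ≡.refl → refl }
  ; bijective = inj , λ y → proj₁ (surj y) , λ { ≡.refl → proj₂ (surj y) }
  }
  where open Setoid S

Restrict : (S : Setoid a ℓ) → U.Pred (Setoid.Carrier S) p → Setoid (a ⊔ p) ℓ
Restrict S P = record
  { Carrier       = Σ (Setoid.Carrier S) P
  ; isEquivalence = On.isEquivalence proj₁ (Setoid.isEquivalence S)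
  }

module _ (S : Setoid a ℓ) where
  open Setoid S
  open Unique S using (Unique)

  lookup-injective : ∀ {xs} → Unique xs → ∀ {i j} → lookup xs i ≈ lookup xs j → i ≡ j
  lookup-injective (_ AllPairs.∷ _)  {zero}  {zero}  _  = ≡.refl
  lookup-injective (x∉ AllPairs.∷ _) {zero}  {suc j} eq =
    contradiction eq (All.lookup x∉ (∈-lookup j))
  lookup-injective (x∉ AllPairs.∷ _) {suc i} {zero}  eq =
    contradiction (sym eq) (All.lookup x∉ (∈-lookup i))
  lookup-injective (_ AllPairs.∷ u)  {suc i} {suc j} eq =
    ≡.cong suc (lookup-injective u eq)

module _ {S : Setoid a ℓ} (F : Finite S) where
  open Setoid S
  open Finite F

  index↔ : Inverse (≡.setoid (Fin card)) S
  index↔ = mk↔ₛ S (lookup elements) (lookup-injective S unique)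
    λ y → Any.index (complete y) , sym (Any.lookup-index (complete y))

  module _ {P : U.Pred Carrier p} (P? : U.Decidable P)
           (resp : ∀ {x y} → x ≈ y → P x → P y) where

    -- The filtered listing is duplicate-free and meets all of `P` up to `_≈_`, so its positions
    -- index that subset. Counts of edges become bijections this way.
    count↔ : Inverse (≡.setoid (Fin (count P?))) (Restrict S P)
    count↔ = mk↔ₛ (Restrict S P)
      (λ i → lookup xs i , All.lookup (All.all-filter P? elements) (∈-lookup i))
      (lookup-injective S (Uniqueₚ.filter⁺ S P? unique))
      λ (y , py) → let y∈ = Membershipₚ.∈-filter⁺ S P? resp (complete y) py in
        Any.index y∈ , sym (Any.lookup-index y∈)
      where xs = filter P? elements

    count-≡ : Inverse (≡.setoid (Fin n)) (Restrict S P) → count P? ≡ n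
    count-≡ i = Perm.↔⇒≡ (Composition.inverse count↔ (Symmetry.inverse i))

    count-≤1 : (∀ {x y} → P x → P y → x ≈ y) → count P? ≤ 1
    count-≤1 all≈ = Fin.injective⇒≤ {f = λ _ → zero}
      λ _ → Bijection.injective (Inverse⇒Bijection count↔)
        (all≈ (proj₂ (Inverse.to count↔ _)) (proj₂ (Inverse.to count↔ _)))

    count-≤0 : (∀ x → ¬ P x) → count P? ≤ 0
    count-≤0 none = Fin.injective⇒≤ {f = λ i → contradiction (proj₂ (Inverse.to count↔ i)) (none _)}
      λ {i} → contradiction (proj₂ (Inverse.to count↔ i)) (none _)

    count-≥1 : ∀ x → P x → 1 ≤ count P?
    count-≥1 x px = Membershipₚ.∈-length S
      (Membershipₚ.∈-filter⁺ S P? resp (complete x) px)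

length≡1⇒≡ : ∀ {xs : List X} {x y} → length xs ≡ 1 → x ∈ xs → y ∈ xs → x ≡ y
length≡1⇒≡ {xs = _ ∷ []} _ (Any.here p) (Any.here q) = ≡.trans p (≡.sym q)

-- Automata and their underlying graphs.

finFin : ∀ n → Finite (≡.setoid (Fin n))
finFin n = enumerated _ Fin._≟_ (allFin n) ∈-allFin

-- The underlying graph of an automaton; the letters only tell edges apart.
graph : Finite (≡.setoid X) → (X → Fin k → X) → Graph
graph {X} {k} finX δ = record
  { V      = ≡.setoid X
  ; E      = ≡.setoid (X × Fin k)
  ; source = record { to = proj₁ ; cong = ≡.cong proj₁ }
  ; target = record { to = uncurry δ ; cong = ≡.cong (uncurry δ) }
  ; finV   = finX
  ; finE   = enumerated _ (Product.≡-dec _≟_ Fin._≟_)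
      (cartesianProduct elements (allFin k))
      (λ (x , c) → ∈-cartesianProduct⁺ (complete x) (∈-allFin c))
  }
  where open Finite finX

-- The automaton form of `_♯`. The loop is the letter `zero`, the one that the cover replaces by a
-- chain.
addLoops : (X → Fin k → X) → X → Fin (suc k) → X
addLoops δ x zero    = x
addLoops δ x (suc c) = δ x c

-- Out-regular graphs as automata.

module _ (K : Graph) where
  private
    module K = Graph K
    module V = Setoid K.V
    module E = Setoid K.E

  Path-respˡ : ∀ {u v w} → u K.≈ᵥ v → K.Path v w → K.Path u w
  Path-respˡ u≈v (K.nil v≈w)    = K.nil (V.trans u≈v v≈w)
  Path-respˡ u≈v (K.cons e p q) = K.cons e (V.trans p (V.sym u≈v)) q

  Path-trans : ∀ {u v w} → K.Path u v → K.Path v w → K.Path u w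
  Path-trans (K.nil u≈v)    q = Path-respˡ u≈v q
  Path-trans (K.cons e p r) q = K.cons e p (Path-trans r q)

  stronglyConnected-resp-≅ : ∀ {G} → K ≅ G → StronglyConnected G → StronglyConnected K
  stronglyConnected-resp-≅ {G} φ conn u v =
    Path-respˡ (V.sym (onV.strictlyInverseʳ u))
      (Path-trans (pull (conn _ _)) (K.nil (onV.strictlyInverseʳ v)))
    where
    module G = Graph G
    module onV = Inverse (_≅_.onV φ)
    module φ⁻¹ = _≅_ (≅-sym φ)
    pull : ∀ {u v} → G.Path u v → K.Path (onV.from u) (onV.from v)
    pull (G.nil u≈v)      = K.nil (onV.from-cong u≈v)
    pull (G.cons e s≈u p) = K.cons φ⁻¹.e⟨ e ⟩ (V.trans (φ⁻¹.source-comm e) (onV.from-cong s≈u))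
      (Path-respˡ (φ⁻¹.target-comm e) (pull p))

  out-resp : ∀ {v e e′} → e K.≈ₑ e′ → K.s e K.≈ᵥ v → K.s e′ K.≈ᵥ v
  out-resp e≈e′ = V.trans (V.sym (Func.cong K.source e≈e′))

  isOut⁺ : {finX : Finite (≡.setoid X)} {δ : X → Fin k → X} →
           graph finX δ ≅ K → IsOut K k
  isOut⁺ {X} {k} φ v = count-≡ K.finE (λ e → K.s e K.≟ᵥ v) out-resp (mk↔ₛ (K.Out v)
    (λ c → e⟨ onV.from v , c ⟩ ,
           V.trans (source-comm (onV.from v , c)) (onV.strictlyInverseˡ v))
    (λ {c} {d} eq → ≡.cong proj₂
      (Bijection.injective (Inverse⇒Bijection onE) {onV.from v , c} {onV.from v , d} eq))
    surjective)
    where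
    open _≅_ φ
    module onV = Inverse onV
    module onE = Inverse onE
    surjective : ∀ ((e , _) : Setoid.Carrier (K.Out v)) →
                 ∃ λ c → e⟨ onV.from v , c ⟩ K.≈ₑ e
    surjective (e , s≈v) = proj₂ (onE.from e) , E.trans
      (onE.to-cong (≡.cong (_, proj₂ (onE.from e)) source-from)) (onE.strictlyInverseˡ e)
      where
      source-from : onV.from v ≡ proj₁ (onE.from e)
      source-from = onV.inverseʳ (V.trans (V.sym s≈v)
        (V.trans (V.sym (Func.cong K.source (onE.strictlyInverseˡ e))) (source-comm (onE.from e))))

  -- The out-edges of each vertex are numbered by the `k` letters, independently of the other
  -- vertices. An edge thus becomes a pair of a source and a letter, and vertices get propositional
  -- equality.
  isOut⁻ : IsOut K k → ∃ λ (δ : Fin (#V K) → Fin k → Fin (#V K)) →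
           graph (finFin _) δ ≅ K
  isOut⁻ {k} isOut = (λ i c → vertex.from (K.t (out i c))) , record
    { onV = index↔ K.finV
    ; onE = mk↔ₛ K.E (uncurry out) injective surjective
    ; source-comm = λ (i , c) → proj₂ (Inverse.to (out↔ i) c)
    ; target-comm = λ _ → V.sym (vertex.strictlyInverseˡ _)
    }
    where
    module vertex = Inverse (index↔ K.finV)
    out↔ : ∀ i → Inverse (≡.setoid (Fin k)) (K.Out (vertex.to i))
    out↔ i = ≡.subst (λ n → Inverse (≡.setoid (Fin n)) (K.Out (vertex.to i)))
      (isOut (vertex.to i)) (count↔ K.finE (λ e → K.s e K.≟ᵥ vertex.to i) out-resp)
    out : ∀ i → Fin k → K.Edge
    out i c = proj₁ (Inverse.to (out↔ i) c)
    injective : ∀ {x y} → uncurry out x K.≈ₑ uncurry out y → x ≡ y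
    injective {i , c} {j , d} eq
      with ≡.refl ← Bijection.injective (Inverse⇒Bijection (index↔ K.finV))
        (V.trans (V.sym (proj₂ (Inverse.to (out↔ i) c)))
          (V.trans (Func.cong K.source eq) (proj₂ (Inverse.to (out↔ j) d))))
      = ≡.cong (i ,_) (Bijection.injective (Inverse⇒Bijection (out↔ i)) eq)
    surjective : ∀ e → ∃ λ x → uncurry out x K.≈ₑ e
    surjective e = (i , Inverse.from (out↔ i) (e , s≈i)) ,
                   Inverse.strictlyInverseˡ (out↔ i) (e , s≈i)
      where
      i = vertex.from (K.s e)
      s≈i = V.sym (vertex.strictlyInverseˡ (K.s e))

  ♯-graph : {finX : Finite (≡.setoid X)} {δ : X → Fin k → X} →
            graph finX δ ≅ K → graph finX (addLoops δ) ≅ (K ♯)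
  ♯-graph {X} {k} {finX} {δ} φ = record
    { onV = onV
    ; onE = mk↔ₛ (Graph.E (K ♯)) to injective surjective
    ; source-comm = λ { (x , zero) → V.refl ; (x , suc c) → source-comm (x , c) }
    ; target-comm = λ { (x , zero) → V.refl ; (x , suc c) → target-comm (x , c) }
    }
    where
    open _≅_ φ
    to : X × Fin (suc k) → Graph.Edge (K ♯)
    to (x , zero)  = inj₂ v⟨ x ⟩
    to (x , suc c) = inj₁ e⟨ x , c ⟩
    injective : ∀ {x y} → Graph._≈ₑ_ (K ♯) (to x) (to y) → x ≡ y
    injective {x , zero}  {y , zero}  (⊎.inj₂ eq) = ≡.cong (_, zero)
      (Bijection.injective (Inverse⇒Bijection onV) eq)
    injective {x , suc c} {y , suc d} (⊎.inj₁ eq) with ≡.refl ←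
      Bijection.injective (Inverse⇒Bijection onE) {x , c} {y , d} eq = ≡.refl
    surjective : ∀ y → ∃ λ x → Graph._≈ₑ_ (K ♯) (to x) y
    surjective (inj₁ e) = (proj₁ (Inverse.from onE e) , suc (proj₂ (Inverse.from onE e))) ,
                          ⊎.inj₁ (Inverse.strictlyInverseˡ onE e)
    surjective (inj₂ v) = (Inverse.from onV v , zero) , ⊎.inj₂ (Inverse.strictlyInverseˡ onV v)

-- Quotients by the kernel of an automaton homomorphism.

module _ (finX : Finite (≡.setoid X)) (finY : Finite (≡.setoid Y))
         (δ : X → Fin k → X) (π : X → Y) where

  kernel : VertexEquivalence (graph finX δ)
  kernel = record
    { _~_           = λ x y → π x ≡ π y
    ; isEquivalence = On.isEquivalence π ≡.isEquivalence
    ; ≈⇒~           = ≡.cong π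
    ; _~?_          = λ x y → Finite._≟_ finY (π x) (π y)
    }

  open VertexEquivalence kernel

  module _ (ε : Y → Fin k → Y) (π-homo : ∀ x c → π (δ x c) ≡ ε (π x) c)
           (ε-injective : ∀ y {c d} → ε y c ≡ ε y d → c ≡ d) where

    private
      module G = Graph (graph finX δ)

      Between : X → X → U.Pred G.Edge 0ℓ
      Between p q e = G.s e ≡ p × π (G.t e) ≡ π q

      between? : ∀ p q → U.Decidable (Between p q)
      between? p q e = (G.s e G.≟ᵥ p) ×-dec (G.t e ~? q)

      between-resp : ∀ {p q e e′} → e ≡ e′ → Between p q e → Between p q e′
      between-resp ≡.refl b = b

      between-unique : ∀ {p q e e′} → Between p q e → Between p q e′ → e ≡ e′
      between-unique {p} {e = _ , c} {_ , d} (≡.refl , r) (≡.refl , r′) = ≡.cong (p ,_)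
        (ε-injective (π p) (≡.trans (≡.sym (π-homo p c))
          (≡.trans r (≡.trans (≡.sym r′) (π-homo p d)))))

    multiplicity-≤ : ∀ {p q n} → (∀ {p′} → π p ≡ π p′ → G.#E (between? p′ q) ≤ n) →
                     multiplicity p q ≤ n
    multiplicity-≤ {p} {q} bound = Extrema.max≤v⁺ z≤n
      (All.map⁺ (All.map bound (All.all-filter (p ~?_) G.vertices)))

    -- The map `π` keeps letters, and by `ε-injective` different letters lead from one class to
    -- different classes.
    multiplicity-≤1 : ∀ p q → multiplicity p q ≤ 1
    multiplicity-≤1 p q = multiplicity-≤ {p} {q} λ {p′} _ →
      count-≤1 G.finE (between? p′ q) between-resp between-unique

    multiplicity-≥1 : ∀ {p q} c → ε (π p) c ≡ π q → 1 ≤ multiplicity p q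
    multiplicity-≥1 {p} {q} c eq = Extrema.v≤max⁺ 0 _ (inj₂ (Any.map⁺
      (Any.map (λ { ≡.refl → count-≥1 G.finE (between? p q) between-resp (p , c)
                     (≡.refl , ≡.trans (π-homo p c) eq) })
        (Membershipₚ.∈-filter⁺ G.V (p ~?_) (λ { ≡.refl r → r }) (Finite.complete finX p) ≡.refl))))

    -- If no letter of `ε` joined the two classes, no vertex in the class of `p` would have an edge
    -- into that of `q`, and the maximum would be 0.
    edge-between : ∀ {p q} → Fin (multiplicity p q) → ∃ λ c → ε (π p) c ≡ π q
    edge-between {p} {q} i with Fin.any? (λ c → Finite._≟_ finY (ε (π p) c) (π q))
    ... | yes e = e
    ... | no ∄  = contradiction (≡.subst Fin (ℕ.n≤0⇒n≡0 mult≤0) i) λ ()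
      where
      mult≤0 : multiplicity p q ≤ 0
      mult≤0 = multiplicity-≤ {p} {q} λ {p′} p~p′ → count-≤0 G.finE (between? p′ q) between-resp
        λ { (_ , c) (≡.refl , r) → ∄ (c , ≡.trans (≡.cong (λ y → ε y c) p~p′)
                                            (≡.trans (≡.sym (π-homo p′ c)) r)) }

    -- Here `σ` picks a representative of each class. A letter at `y` becomes the edge of index 0
    -- between representatives, the only edge there.
    quotient≅ : (σ : Y → X) → (∀ y → π (σ y) ≡ y) → graph finY ε ≅ (graph finX δ / kernel)
    quotient≅ σ π∘σ = record
      { onV = mk↔ₛ classes σ
          (λ {x} {y} eq → ≡.trans (≡.sym (π∘σ x)) (≡.trans eq (π∘σ y)))
          (λ x → π x , π∘σ (π x))
      ; onE = mk↔ₛ Q.E to injective surjective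
      ; source-comm = λ _ → ≡.refl
      ; target-comm = λ _ → ≡.refl
      }
      where
      module Q = Graph (graph finX δ / kernel)
      to : Y × Fin k → Q.Edge
      to (y , c) = σ y , σ (ε y c) , fromℕ< (multiplicity-≥1 c
        (≡.trans (≡.cong (λ z → ε z c) (π∘σ y)) (≡.sym (π∘σ (ε y c)))))
      injective : ∀ {x y} → to x Q.≈ₑ to y → x ≡ y
      injective {x , c} {y , d} (p , q , _)
        with ≡.refl ← ≡.trans (≡.sym (π∘σ x)) (≡.trans p (π∘σ y)) = ≡.cong (x ,_)
          (ε-injective x (≡.trans (≡.sym (π∘σ _)) (≡.trans q (π∘σ _))))
      surjective : ∀ e → ∃ λ x → to x Q.≈ₑ e
      surjective (p , q , i) with edge-between {p} {q} i
      ... | c , eq = (π p , c) , π∘σ (π p) , ≡.trans (π∘σ _) eq ,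
        -- The index `i` is below a multiplicity of at most 1, hence is 0.
        ≡.trans (Fin.toℕ-fromℕ< _)
          (≡.sym (ℕ.n<1⇒n≡0 (ℕ.<-≤-trans (Fin.toℕ<n i) (multiplicity-≤1 p q))))

-- The cover and the action of `H` on it.

module Cover {c ℓ} (H : Group c ℓ) (finH : FiniteGroup H) {m k : ℕ}
             (tgt : Fin (suc m) → Fin k → Fin (suc m))
             (gens : Fin (suc m) → Group.Carrier H) where

  open Group H
  open Finite finH using (card)
  private module element = Inverse (index↔ finH)
  open element using () renaming (to to el; from to ix)
  open import Algebra.Properties.Group H
    using (inverseˡ-unique; inverseʳ-unique; identityˡ-unique; ∙-cancelˡ)
  open import Algebra.Properties.Monoid.Mult monoid using (×-homo-+) renaming (_×_ to _×ᵐ_)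

  el∘ix : ∀ x → el (ix x) ≈ x
  el∘ix = element.strictlyInverseˡ

  ix∘el : ∀ i → ix (el i) ≡ i
  ix∘el = element.strictlyInverseʳ

  -- Group elements are stored as indices in `Fin card`, which gives vertices propositional equality
  -- although `H` is a setoid. Chains over different classes have different lengths, which later
  -- tells the classes apart.
  Vtx : Set
  Vtx = Σ (Fin (suc m)) λ a → Fin card × Fin (suc (toℕ a))

  finVtx : Finite (≡.setoid Vtx)
  finVtx = enumerated _
    (Product.≡-dec Fin._≟_ (Product.≡-dec Fin._≟_ Fin._≟_))
    (concatMap (λ a → map (a ,_) (cartesianProduct (allFin _) (allFin _))) (allFin _))
    λ (a , h , j) → Any.concatMap⁺ _ (Any.map
      (λ { ≡.refl → ∈-map⁺ (a ,_) (∈-cartesianProduct⁺ (∈-allFin h) (∈-allFin j)) })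
      (∈-allFin a))

  class : Vtx → Fin (suc m)
  class = proj₁

  base : Vtx → Fin card
  base = proj₁ ∘ proj₂

  height : Vtx → ℕ
  height x = toℕ (proj₂ (proj₂ x))

  Vtx-≡ : ∀ {x y} → class x ≡ class y → base x ≡ base y → height x ≡ height y → x ≡ y
  Vtx-≡ {a , h , _} ≡.refl ≡.refl eq = ≡.cong (λ j → a , h , j) (Fin.toℕ-injective eq)

  infixl 7 _◁_
  -- Right multiplication, which commutes with the left multiplication in `act`.
  _◁_ : Fin card → Carrier → Fin card
  h ◁ x = ix (el h ∙ x)

  entrance : Fin (suc m) → Fin card → Vtx
  entrance a h = a , h , fromℕ (toℕ a)

  Entrance : Vtx → Set
  Entrance x = height x ≡ toℕ (class x)

  δ : Vtx → Fin (suc k) → Vtx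
  δ (a , h , _)     (suc i) = entrance (tgt a i) h
  δ (a , h , zero)  zero    = entrance a (h ◁ gens a)
  δ (a , h , suc j) zero    = a , h , inject₁ j

  G : Graph
  G = graph finVtx δ

  private module G = Graph G

  class-homo : ∀ x i → class (δ x i) ≡ addLoops tgt (class x) i
  class-homo (a , h , zero)  zero    = ≡.refl
  class-homo (a , h , suc j) zero    = ≡.refl
  class-homo (a , h , _)     (suc i) = ≡.refl

  act : Carrier → Vtx → Vtx
  act g (a , h , j) = a , ix (g ∙ el h) , j

  act-homo : ∀ g x i → act g (δ x i) ≡ δ (act g x) i
  act-homo g (a , h , zero)  zero    = ≡.cong (entrance a) (element.from-cong
    (trans (∙-congˡ (el∘ix _)) (trans (sym (assoc _ _ _)) (∙-congʳ (sym (el∘ix _))))))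
  act-homo g (a , h , suc j) zero    = ≡.refl
  act-homo g (a , h , _)     (suc i) = ≡.refl

  act-cong : ∀ {g g′} x → g ≈ g′ → act g x ≡ act g′ x
  act-cong (a , h , j) eq = ≡.cong (λ h → a , h , j) (element.from-cong (∙-congʳ eq))

  act-∙ : ∀ g g′ x → act g (act g′ x) ≡ act (g ∙ g′) x
  act-∙ g g′ (a , h , j) = ≡.cong (λ h → a , h , j)
    (element.from-cong (trans (∙-congˡ (el∘ix _)) (sym (assoc _ _ _))))

  act-ε : ∀ x → act ε x ≡ x
  act-ε (a , h , j) = ≡.cong (λ h → a , h , j) (≡.trans (element.from-cong (identityˡ _)) (ix∘el h))

  act-free : ∀ g x → act g x ≡ x → g ≈ ε
  act-free g (a , h , j) eq = identityˡ-unique g (el h)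
    (trans (sym (el∘ix _)) (reflexive (≡.cong (el ∘ base) eq)))

  ◁-∙ : ∀ h x y → h ◁ (x ∙ y) ≡ (h ◁ x) ◁ y
  ◁-∙ h x y = element.from-cong (trans (sym (assoc _ _ _)) (∙-congʳ (sym (el∘ix _))))

  ◁-ε : ∀ h → h ◁ ε ≡ h
  ◁-ε h = ≡.trans (element.from-cong (identityʳ _)) (ix∘el h)

  -- Strong connectivity of the cover.

  path-δ : ∀ {x y} i → δ x i ≡ y → G.Path x y
  path-δ {x} i eq = G.cons (x , i) ≡.refl (G.nil eq)

  entrance-path : ∀ a h j → G.Path (entrance a h) (a , h , j)
  entrance-path a h = >-weakInduction _ (G.nil ≡.refl)
    λ j p → Path-trans G p (path-δ zero ≡.refl)

  exit-path : ∀ a h j → G.Path (a , h , j) (entrance a (h ◁ gens a))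
  exit-path a h = <-weakInduction _ (path-δ zero ≡.refl)
    λ j p → Path-trans G (path-δ zero ≡.refl) p

  tgt-graph : Graph
  tgt-graph = graph (finFin (suc m)) tgt

  private module Γ = Graph tgt-graph

  -- The letters of Γ keep the group element and end at entrances, so every walk lifts with `h`
  -- fixed.
  lift-path : ∀ {a b} h → Γ.Path a b → G.Path (entrance a h) (entrance b h)
  lift-path h (Γ.nil ≡.refl)            = G.nil ≡.refl
  lift-path h (Γ.cons (a , i) ≡.refl p) = G.cons (entrance a h , suc i) ≡.refl (lift-path h p)

  -- Walks cannot be reversed, so inverses have to be powers. By pigeonhole two exponents `i < j`
  -- among `0, …, card` give the same power, and `r = j - i - 1`.
  inverse-power : ∀ x → ∃ λ r → (r ×ᵐ x) ≈ x ⁻¹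
  inverse-power x with Fin.pigeonhole (ℕ.n<1+n card) (λ i → ix (toℕ i ×ᵐ x))
  ... | i , j , i<j , eq with ℕ.m≤n⇒∃[o]m+o≡n i<j
  ... | r , i+r≡j = r , inverseʳ-unique x (r ×ᵐ x) (∙-cancelˡ (toℕ i ×ᵐ x) _ _ (begin
    toℕ i ×ᵐ x ∙ suc r ×ᵐ x   ≈⟨ ×-homo-+ x (toℕ i) (suc r) ⟨
    (toℕ i ℕ+ suc r) ×ᵐ x     ≡⟨ ≡.cong (_×ᵐ x) (≡.trans (ℕ.+-suc (toℕ i) r) i+r≡j) ⟩
    toℕ j ×ᵐ x                ≈⟨ el∘ix _ ⟨
    el (ix (toℕ j ×ᵐ x))      ≡⟨ ≡.cong el eq ⟨
    el (ix (toℕ i ×ᵐ x))      ≈⟨ el∘ix _ ⟩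
    toℕ i ×ᵐ x                ≈⟨ identityʳ _ ⟨
    toℕ i ×ᵐ x ∙ ε            ∎))
    where open import Relation.Binary.Reasoning.Setoid setoid

  module _ (conn : StronglyConnected tgt-graph) where

    -- Uniform in the class and the group element, so that walks for two factors concatenate to one
    -- for their product.
    Reachable : Carrier → Set
    Reachable x = ∀ a h → G.Path (entrance a h) (entrance a (h ◁ x))

    reachable-ε : Reachable ε
    reachable-ε a h = G.nil (≡.cong (entrance a) (≡.sym (◁-ε h)))

    reachable-∙ : ∀ {x y} → Reachable x → Reachable y → Reachable (x ∙ y)
    reachable-∙ p q a h = Path-trans G (p a h)
      (Path-trans G (q a _) (G.nil (≡.cong (entrance a) (≡.sym (◁-∙ h _ _)))))

    reachable-× : ∀ {x} → Reachable x → ∀ r → Reachable (r ×ᵐ x)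
    reachable-× p zero    = reachable-ε
    reachable-× p (suc r) = reachable-∙ p (reachable-× p r)

    reachable-resp : ∀ {x y} → x ≈ y → Reachable x → Reachable y
    reachable-resp eq p a h = Path-trans G (p a h)
      (G.nil (≡.cong (entrance a) (element.from-cong (∙-congˡ eq))))

    reachable : ∀ {x} → ⟨_⟩ H gens x → Reachable x
    -- Go to the class `b`, run down its chain once to multiply by its generator, and come back.
    reachable (gen b) a h = Path-trans G (lift-path h (conn a b))
      (Path-trans G (exit-path b h _) (lift-path _ (conn b a)))
    reachable unit          = reachable-ε
    reachable (mul p q)     = reachable-∙ (reachable p) (reachable q)
    reachable (inv {x} p)   = reachable-resp (proj₂ (inverse-power x))
      (reachable-× (reachable p) (proj₁ (inverse-power x)))
    reachable (resp eq p)   = reachable-resp eq (reachable p)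

    stronglyConnected : (∀ x → ⟨_⟩ H gens x) → StronglyConnected G
    stronglyConnected generates (a , h , j) (b , h′ , j′) =
      -- Leave the chain, correct the group element to `h′` while still over `a`, then move to `b`
      -- and down to `j′`.
      Path-trans G (exit-path a h j)
        (Path-trans G (reachable (generates (el (h ◁ gens a) ⁻¹ ∙ el h′)) a _)
          (Path-trans G (lift-path _ (conn a b))
            (Path-respˡ G (≡.cong (entrance b) eq) (entrance-path b h′ j′))))
      where
      g = el (h ◁ gens a)
      eq : ix (g ∙ (g ⁻¹ ∙ el h′)) ≡ h′
      eq = ≡.trans (element.from-cong (trans (sym (assoc _ _ _))
             (trans (∙-congʳ (inverseʳ g)) (identityˡ _)))) (ix∘el h′)

  -- The congruence, and a colouring without reset word.

  sameClass : VertexEquivalence G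
  sameClass = kernel finVtx (finFin (suc m)) δ class

  module _ (addLoops-injective : ∀ a {i j} → addLoops tgt a i ≡ addLoops tgt a j → i ≡ j) where

    base≅quotient : graph (finFin (suc m)) (addLoops tgt) ≅ (G / sameClass)
    base≅quotient = quotient≅ {X = Vtx} {Y = Fin (suc m)} {k = suc k}
      finVtx (finFin (suc m)) δ class (addLoops tgt) class-homo
      addLoops-injective (λ a → entrance a (ix ε)) (λ _ → ≡.refl)

    isCongruence : IsCongruence (suc k) G sameClass
    isCongruence = isOut⁺ (G / sameClass) base≅quotient

  isOut : IsOut G (suc k)
  isOut = isOut⁺ G ≅-refl

  -- Colouring each edge by its letter gives back `δ`, with which `act` commutes.
  coloring : Coloring (suc k) G
  coloring = record
    { χ = record { to = proj₂ ; cong = ≡.cong proj₂ }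
    ; bijective = λ v → (λ { {(_ , ≡.refl)} {(_ , ≡.refl)} eq → ≡.cong (v ,_) eq }) ,
                        λ i → ((v , i) , ≡.refl) , ≡.cong proj₂
    }

  act-foldl : ∀ g w x → act g (foldl δ x w) ≡ foldl δ (act g x) w
  act-foldl g []      x = ≡.refl
  act-foldl g (i ∷ w) x = ≡.trans (act-foldl g w (δ x i))
    (≡.cong (λ y → foldl δ y w) (act-homo g x i))

  -- An image point of a reset word would be fixed by the free action of H.
  ¬totallySynchronizing : Nontrivial H → ¬ TotallySynchronizing (suc k) G
  ¬totallySynchronizing (g , g≉ε) sync with sync coloring
  ... | w , one = g≉ε (act-free g (foldl δ x₀ w)
    (≡.trans (act-foldl g w x₀) (length≡1⇒≡ one (image (act g x₀)) (image x₀))))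
    where
    x₀ = entrance zero (ix ε)
    image : ∀ x → foldl δ x w ∈ deduplicate G._≟ᵥ_ (map (λ x → foldl δ x w) G.vertices)
    image x = ∈-deduplicate⁺ G._≟ᵥ_ (∈-map⁺ _ (Finite.complete finVtx x))

  -- In-neighbours of entrances and of other vertices.

  nonentrance-pred : ∀ x i → ¬ Entrance (δ x i) →
                     class x ≡ class (δ x i) × base x ≡ base (δ x i) ×
                     height x ≡ suc (height (δ x i))
  -- Edges of Γ and the jump from the bottom of a chain end at entrances, so only a step down a
  -- chain is left.
  nonentrance-pred (a , h , _)     (suc i) ne = contradiction (Fin.toℕ-fromℕ _) ne
  nonentrance-pred (a , h , zero)  zero    ne = contradiction (Fin.toℕ-fromℕ _) ne
  nonentrance-pred (a , h , suc j) zero    ne =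
    ≡.refl , ≡.refl , ≡.cong suc (≡.sym (Fin.toℕ-inject₁ j))

  nonentrance-unique-pred : ∀ {x x′ i i′ y} → δ x i ≡ y → δ x′ i′ ≡ y → ¬ Entrance y → x ≡ x′
  nonentrance-unique-pred {x} {x′} {i} {i′} ≡.refl eq ne
    with p , q , r ← nonentrance-pred x i ne
       | p′ , q′ , r′ ← nonentrance-pred x′ i′ (≡.subst (¬_ ∘ Entrance) (≡.sym eq) ne)
    = Vtx-≡ (≡.trans p (≡.trans (≡.cong class (≡.sym eq)) (≡.sym p′)))
            (≡.trans q (≡.trans (≡.cong base (≡.sym eq)) (≡.sym q′)))
            (≡.trans r (≡.trans (≡.cong (suc ∘ height) (≡.sym eq)) (≡.sym r′)))

  -- On a walk that starts outside `a`, the edge by which `a` is first reached comes from a vertex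
  -- other than `a`.
  last-edge : ∀ {a b} → Γ.Path b a → b ≢ a → ∃ λ u → ∃ λ i → u ≢ a × tgt u i ≡ a
  last-edge (Γ.nil b≡a) b≢a = contradiction b≡a b≢a
  last-edge {a} (Γ.cons (u , i) ≡.refl p) u≢a with tgt u i Fin.≟ a
  ... | yes eq = u , i , u≢a , eq
  ... | no  ne = last-edge p ne

  -- One in-neighbour is an entrance over another class, found by `last-edge` on a walk from `b`;
  -- the other is the bottom of a chain over the same class, at `h` times the inverse generator.
  entrance-preds : StronglyConnected tgt-graph → ∀ {y b} → Entrance y → b ≢ class y →
                   ∃ λ x → ∃ λ x′ → x ≢ x′ × (∃ λ i → δ x i ≡ y) × (∃ λ i → δ x′ i ≡ y)
  entrance-preds conn {y@(a , h , j)} {b} top b≢a with last-edge (conn b a) b≢a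
  ... | u , i , u≢a , eq =
    entrance u h , (a , h ◁ gens a ⁻¹ , zero) , u≢a ∘ ≡.cong class ,
    (suc i , Vtx-≡ eq ≡.refl (≡.trans (Fin.toℕ-fromℕ _) (≡.trans (≡.cong toℕ eq) (≡.sym top)))) ,
    (zero , Vtx-≡ ≡.refl
      (≡.trans (≡.sym (◁-∙ h _ _)) (≡.trans (element.from-cong (∙-congˡ (inverseˡ _))) (◁-ε h)))
      (≡.trans (Fin.toℕ-fromℕ _) (≡.sym top)))

  -- Automorphisms of the cover.

  module Automorphisms (conn : StronglyConnected tgt-graph)
    (addLoops-injective : ∀ a {i j} → addLoops tgt a i ≡ addLoops tgt a j → i ≡ j) where

    move : G ≅ G → Vtx → Vtx
    move φ = v⟨_⟩ where open _≅_ φ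

    move-injective : ∀ φ {x y} → move φ x ≡ move φ y → x ≡ y
    move-injective φ = Bijection.injective (Inverse⇒Bijection (_≅_.onV φ))

    unmove : ∀ φ x → move (≅-sym φ) (move φ x) ≡ x
    unmove φ = Inverse.strictlyInverseʳ (_≅_.onV φ)

    -- A priori an automorphism may change letters, hence the new letter `j`; `move-homo` shows that
    -- it does not.
    move-step : ∀ φ x i → ∃ λ j → δ (move φ x) j ≡ move φ (δ x i)
    move-step φ x i = proj₂ e⟨ x , i ⟩ ,
      ≡.trans (≡.cong (λ y → δ y _) (≡.sym (source-comm (x , i)))) (target-comm (x , i))
      where open _≅_ φ

    -- Outside the trivial one-class case entrances are the vertices with at
    -- least two in-neighbours.
    move-entrance : ∀ φ y → Entrance y → Entrance (move φ y)
    move-entrance φ y top with height (move φ y) ℕ.≟ toℕ (class (move φ y))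
    ... | yes e = e
    ... | no ne with entrance-preds conn {y} top (proj₂ other)
      where
      -- Over `zero` every vertex has height 0 and is an entrance. An image that is not an entrance
      -- therefore has a nonzero class, so there are two classes.
      class≢0 : class (move φ y) ≢ zero
      class≢0 eq = ne (≡.trans (ℕ.n<1⇒n≡0 (≡.subst (λ a → height (move φ y) < suc (toℕ a)) eq
        (Fin.toℕ<n _))) (≡.sym (≡.cong toℕ eq)))
      other : ∃ λ b → b ≢ class y
      other with class y Fin.≟ zero
      ... | yes eq = class (move φ y) , λ eq′ → class≢0 (≡.trans eq′ eq)
      ... | no y≢0 = zero , y≢0 ∘ ≡.sym
    ... | x , x′ , x≢x′ , (i , ≡.refl) , (i′ , eq) = contradiction
      (move-injective φ (nonentrance-unique-pred
        (proj₂ (move-step φ x i))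
        (≡.trans (proj₂ (move-step φ x′ i′)) (≡.cong (move φ) eq)) ne))
      x≢x′

    move-nonentrance : ∀ φ y → ¬ Entrance y → ¬ Entrance (move φ y)
    move-nonentrance φ y ne top =
      ne (≡.subst Entrance (unmove φ y) (move-entrance (≅-sym φ) (move φ y) top))

    inject₁-nonentrance : ∀ a h (j : Fin (toℕ a)) → ¬ Entrance (a , h , inject₁ j)
    inject₁-nonentrance a h j =
      ℕ.<⇒≢ (≡.subst (_< toℕ a) (≡.sym (Fin.toℕ-inject₁ j)) (Fin.toℕ<n j))

    -- The lower vertex is not an entrance, so neither is its image, whose only in-neighbour lies
    -- one step higher in the same chain.
    descend : ∀ φ {a} h (j : Fin (toℕ a)) →
              class (move φ (a , h , suc j)) ≡ class (move φ (a , h , inject₁ j)) ×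
              height (move φ (a , h , suc j)) ≡ suc (height (move φ (a , h , inject₁ j)))
    descend φ {a} h j with move-step φ (a , h , suc j) zero
    ... | i , eq
      with p , _ , r ← nonentrance-pred (move φ (a , h , suc j)) i
        (≡.subst (¬_ ∘ Entrance) (≡.sym eq)
          (move-nonentrance φ (a , h , inject₁ j) (inject₁-nonentrance a h j)))
      = ≡.trans p (≡.cong class eq) , ≡.trans r (≡.cong (suc ∘ height) eq)

    -- By `descend`, each step up a chain raises the height of the image by one.
    move-height-≥ : ∀ φ x → height x ≤ height (move φ x)
    move-height-≥ φ (a , h , j) = <-weakInduction
      (λ j → toℕ j ≤ height (move φ (a , h , j))) z≤n
      (λ i le → ≡.subst₂ _≤_ (≡.cong suc (Fin.toℕ-inject₁ i))
        (≡.sym (proj₂ (descend φ h i))) (s≤s le)) j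

    -- The inverse automorphism gives the reverse inequality.
    move-height : ∀ φ x → height (move φ x) ≡ height x
    move-height φ x = ℕ.≤-antisym
      (≡.subst (λ y → height (move φ x) ≤ height y) (unmove φ x)
        (move-height-≥ (≅-sym φ) (move φ x)))
      (move-height-≥ φ x)

    -- The height of its entrance tells a class from the others.
    move-class : ∀ φ x → class (move φ x) ≡ class x
    move-class φ (a , h , j) = >-weakInduction (λ j → class (move φ (a , h , j)) ≡ a)
      (Fin.toℕ-injective (≡.trans (≡.sym (move-entrance φ (entrance a h) (Fin.toℕ-fromℕ _)))
        (≡.trans (move-height φ (entrance a h)) (Fin.toℕ-fromℕ _))))
      (λ i eq → ≡.trans (≡.sym (proj₁ (descend φ h i))) eq) j

    -- Classes are preserved, and over a given class the class of the target determines the letter.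
    move-homo : ∀ φ x i → move φ (δ x i) ≡ δ (move φ x) i
    move-homo φ x i with move-step φ x i
    ... | j , eq = ≡.trans (≡.sym eq) (≡.cong (δ (move φ x)) (addLoops-injective (class x) (begin
      addLoops tgt (class x) j             ≡⟨ ≡.cong (λ a → addLoops tgt a j) (move-class φ x) ⟨
      addLoops tgt (class (move φ x)) j    ≡⟨ class-homo (move φ x) j ⟨
      class (δ (move φ x) j)               ≡⟨ ≡.cong class eq ⟩
      class (move φ (δ x i))               ≡⟨ move-class φ (δ x i) ⟩
      class (δ x i)                        ≡⟨ class-homo x i ⟩
      addLoops tgt (class x) i             ∎)))
      where open ≡.≡-Reasoning

    δ-injective : ∀ x {i j} → δ x i ≡ δ x j → i ≡ j
    δ-injective x {i} {j} eq = addLoops-injective (class x)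
      (≡.trans (≡.sym (class-homo x i)) (≡.trans (≡.cong class eq) (class-homo x j)))

    -- An automorphism carries an edge map of its own; as different letters at a vertex have
    -- different targets, the vertex map determines it.
    move-edge : ∀ φ x i → _≅_.e⟨_⟩ φ (x , i) ≡ (move φ x , i)
    move-edge φ x i with _≅_.e⟨_⟩ φ (x , i) | _≅_.source-comm φ (x , i) | _≅_.target-comm φ (x , i)
    ... | y , j | ≡.refl | eq = ≡.cong (y ,_) (δ-injective y (≡.trans eq (move-homo φ x i)))

    path-induction : ∀ (P : Vtx → Set) → (∀ x i → P x → P (δ x i)) →
                     ∀ {x y} → G.Path x y → P x → P y
    path-induction P step (G.nil ≡.refl)            px = px
    path-induction P step (G.cons (x , i) ≡.refl p) px = path-induction P step p (step x i px)

    origin : Vtx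
    origin = entrance zero (ix ε)

    shift : G ≅ G → Carrier
    shift φ = el (base (move φ origin))

    module _ (generates : ∀ x → ⟨_⟩ H gens x) where

      -- Both maps commute with the letters, so agreement spreads from `origin` along walks.
      move-act : ∀ φ x → move φ x ≡ act (shift φ) x
      move-act φ x = path-induction (λ x → move φ x ≡ act (shift φ) x)
        (λ x i eq → ≡.trans (move-homo φ x i)
          (≡.trans (≡.cong (λ y → δ y i) eq) (≡.sym (act-homo (shift φ) x i))))
        (stronglyConnected conn generates origin x)
        -- At `origin` the group element is `ε`, so `act (shift φ)` produces the group element of
        -- its image.
        (Vtx-≡ (move-class φ origin)
          (≡.trans (≡.sym (ix∘el _)) (element.from-cong
            (sym (trans (∙-congˡ (el∘ix ε)) (identityʳ _)))))
          (move-height φ origin))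

      translation : Carrier → G ≅ G
      translation g = record
        { onV = record
          { to        = act g
          ; from      = act (g ⁻¹)
          ; to-cong   = ≡.cong (act g)
          ; from-cong = ≡.cong (act (g ⁻¹))
          ; inverse   = (λ { ≡.refl → act-invʳ _ }) , λ { ≡.refl → act-invˡ _ }
          }
        ; onE = record
          { to        = λ (x , i) → act g x , i
          ; from      = λ (x , i) → act (g ⁻¹) x , i
          ; to-cong   = ≡.cong _
          ; from-cong = ≡.cong _
          ; inverse   = (λ { ≡.refl → ≡.cong (_, _) (act-invʳ _) }) ,
                        λ { ≡.refl → ≡.cong (_, _) (act-invˡ _) }
          }
        ; source-comm = λ _ → ≡.refl
        ; target-comm = λ (x , i) → ≡.sym (act-homo g x i)
        }
        where
        act-invʳ : ∀ x → act g (act (g ⁻¹) x) ≡ x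
        act-invʳ x = ≡.trans (act-∙ _ _ x) (≡.trans (act-cong x (inverseʳ g)) (act-ε x))
        act-invˡ : ∀ x → act (g ⁻¹) (act g x) ≡ x
        act-invˡ x = ≡.trans (act-∙ _ _ x) (≡.trans (act-cong x (inverseˡ g)) (act-ε x))

      private module A = Group (Aut G)

      shift-cong : ∀ {φ ψ} → φ A.≈ ψ → shift φ ≈ shift ψ
      shift-cong (eq , _) = reflexive (≡.cong (el ∘ base) (eq origin))

      -- The product in `Aut G` applies `ψ` first, and `φ` then multiplies on the left, so the order
      -- of the factors is kept.
      shift-∙ : ∀ φ ψ → shift (φ A.∙ ψ) ≈ shift φ ∙ shift ψ
      shift-∙ φ ψ = trans (reflexive (≡.cong (el ∘ base) (move-act φ (move ψ origin)))) (el∘ix _)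

      shift-ε : shift A.ε ≈ ε
      shift-ε = el∘ix ε

      shift-injective : ∀ {φ ψ} → shift φ ≈ shift ψ → φ A.≈ ψ
      shift-injective {φ} {ψ} eq = moves , λ (x , i) →
        ≡.trans (move-edge φ x i) (≡.trans (≡.cong (_, i) (moves x)) (≡.sym (move-edge ψ x i)))
        where
        moves : ∀ x → move φ x ≡ move ψ x
        moves x = ≡.trans (move-act φ x) (≡.trans (act-cong x eq) (≡.sym (move-act ψ x)))

      Aut≅H : Aut G ≅ᴳ H
      Aut≅H = shift , record
        { isGroupMonomorphism = record
          { isGroupHomomorphism = record
            { isMonoidHomomorphism = record
              { isMagmaHomomorphism = record
                { isRelHomomorphism = record { cong = λ {φ} {ψ} → shift-cong {φ} {ψ} }
                ; homo              = shift-∙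
                }
              ; ε-homo = shift-ε
              }
            ; ⁻¹-homo = λ φ → inverseˡ-unique _ _ (trans (sym (shift-∙ (φ A.⁻¹) φ))
                (trans (shift-cong {φ A.⁻¹ A.∙ φ} {A.ε} (A.inverseˡ φ)) shift-ε))
            }
          ; injective = λ {φ} {ψ} → shift-injective {φ} {ψ}
          }
        ; surjective = λ g → translation g , λ {φ} eq →
            trans (shift-cong {φ} {translation g} eq)
              (trans (el∘ix _) (trans (∙-congˡ (el∘ix ε)) (identityʳ g)))
        }

-- Generating families of prescribed size.

module _ {c ℓ} (H : Group c ℓ) where
  open Group H
  open import Algebra.Properties.Group H using (ε⁻¹≈ε)

  -- Serves to exclude an empty Γ.
  generates-none : {g : Fin m → Carrier} → ¬ Fin m → ∀ {x} → ⟨_⟩ H g x → x ≈ ε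
  generates-none empty (gen i)     = contradiction i empty
  generates-none empty unit        = refl
  generates-none empty (mul p q)   =
    trans (∙-cong (generates-none empty p) (generates-none empty q)) (identityˡ ε)
  generates-none empty (inv p)     = trans (⁻¹-cong (generates-none empty p)) ε⁻¹≈ε
  generates-none empty (resp eq p) = trans (sym eq) (generates-none empty p)

  generates-⊆ : {g : Fin m → Carrier} {g′ : Fin n → Carrier} →
                (∀ i → ∃ λ j → g′ j ≈ g i) → ∀ {x} → ⟨_⟩ H g x → ⟨_⟩ H g′ x
  generates-⊆ g⊆g′ (gen i)     = resp (proj₂ (g⊆g′ i)) (gen (proj₁ (g⊆g′ i)))
  generates-⊆ g⊆g′ unit        = unit
  generates-⊆ g⊆g′ (mul p q)   = mul (generates-⊆ g⊆g′ p) (generates-⊆ g⊆g′ q)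
  generates-⊆ g⊆g′ (inv p)     = inv (generates-⊆ g⊆g′ p)
  generates-⊆ g⊆g′ (resp eq p) = resp eq (generates-⊆ g⊆g′ p)

  -- The cover takes one element per vertex, repetitions allowed, so the surplus places are filled
  -- with `ε`.
  pad-generators : ∀ {d m} (g : Fin d → Carrier) → d ≤ m → (∀ x → ⟨_⟩ H g x) →
                   Σ (Fin m → Carrier) λ g′ → ∀ x → ⟨_⟩ H g′ x
  pad-generators {d} {m} g d≤m generates = padded , λ x → generates-⊆ included (generates x)
    where
    -- The decision is an argument, so that `pad-inject` can split on it.
    pad : ∀ (i : Fin m) → Dec (toℕ i < d) → Carrier
    pad i (yes i<d) = g (fromℕ< i<d)
    pad i (no _)    = ε
    padded : Fin m → Carrier
    padded i = pad i (toℕ i ℕ.<? d)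
    pad-inject : ∀ i dec → pad (inject≤ i d≤m) dec ≈ g i
    pad-inject i (yes lt) = reflexive (≡.cong g (Fin.toℕ-injective
      (≡.trans (Fin.toℕ-fromℕ< lt) (Fin.toℕ-inject≤ i d≤m))))
    pad-inject i (no ≮)   = contradiction
      (≡.subst (_< d) (≡.sym (Fin.toℕ-inject≤ i d≤m)) (Fin.toℕ<n i)) ≮
    included : ∀ i → ∃ λ j → padded j ≈ g i
    included i = inject≤ i d≤m , pad-inject i (toℕ (inject≤ i d≤m) ℕ.<? d)

-- Application to a graph without loops and parallel edges.

module _ {K : Graph} {finX : Finite (≡.setoid X)} {δ : X → Fin k → X} (φ : graph finX δ ≅ K) where
  private
    module K = Graph K
    module V = Setoid K.V
  open _≅_ φ

  -- Two old letters with the same target would be parallel edges, and an old letter sharing its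
  -- target with the added one would be a loop.
  addLoops-injective : NoLoops K → NoParallelEdges K →
                       ∀ x {i j} → addLoops δ x i ≡ addLoops δ x j → i ≡ j
  addLoops-injective noLoops noParallel x = inj _ _
    where
    ≢-target : ∀ i → x ≢ δ x i
    ≢-target i eq = noLoops e⟨ x , i ⟩ (V.trans (source-comm (x , i))
      (V.trans (V.reflexive (≡.cong v⟨_⟩ eq)) (V.sym (target-comm (x , i)))))
    inj : ∀ i j → addLoops δ x i ≡ addLoops δ x j → i ≡ j
    inj zero    zero    _  = ≡.refl
    inj zero    (suc j) eq = contradiction eq (≢-target j)
    inj (suc i) zero    eq = contradiction (≡.sym eq) (≢-target i)
    inj (suc i) (suc j) eq = ≡.cong (suc ∘ proj₂)
      (Bijection.injective (Inverse⇒Bijection onE) {x , i} {x , j}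
        (noParallel _ _ (V.trans (source-comm (x , i)) (V.sym (source-comm (x , j))))
          (V.trans (target-comm (x , i))
            (V.trans (V.reflexive (≡.cong v⟨_⟩ eq)) (V.sym (target-comm (x , j)))))))

corollary3p25 : ∀ {c ℓ} (k : ℕ) (Γ : Graph) →
    StronglyConnected Γ → IsOut Γ k → NoParallelEdges Γ → NoLoops Γ →
    (H : Group c ℓ) → FiniteGroup H → Nontrivial H →
    (d : ℕ) → IsRank H d → d ≤ #V Γ →
    Σ Graph λ G → Σ (VertexEquivalence G) λ ρ →
    StronglyConnected G × IsOut G (suc k) × IsCongruence (suc k) G ρ ×
    ((G / ρ) ≅ (Γ ♯)) × (Aut G ≅ᴳ H) × ¬ TotallySynchronizing (suc k) G
corollary3p25 k Γ conn isOutΓ noParallel noLoops H finH nontrivial d ((g , _ , generates) , _) d≤#V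
  with #V Γ | isOut⁻ Γ isOutΓ | pad-generators H g d≤#V generates
-- If Γ has no vertices, the padded family is empty and generates only `ε`, although `H` is
-- nontrivial.
... | zero  | _       | _ , generates′ =
  contradiction (generates-none H (λ ()) (generates′ _)) (proj₂ nontrivial)
... | suc m | tgt , φ | gens , generates′ =
  G , sameClass , stronglyConnected conn′ generates′ , isOut , isCongruence injective ,
  ≅-trans (≅-sym (base≅quotient injective)) (♯-graph Γ φ) ,
  Automorphisms.Aut≅H conn′ injective generates′ , ¬totallySynchronizing nontrivial
  where
  open Cover H finH tgt gens
  conn′ = stronglyConnected-resp-≅ tgt-graph φ conn
  injective = addLoops-injective φ noLoops noParallel
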